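{- For any formula $A$ of the language of $\mathsf{ILL}_\bot$, one obtains the linear Gödel-Gentzen translation $A^{\rm lG}$ from the outer Kolmogorov translation $A^{{\rm K}_o}$ by systematically applying the following formula reductions, starting from the whole formula and inductively applying them to the subformulas: $$\neg\neg(\neg\neg A\,\&\,\neg\neg B)\mapsto\neg\neg A\,\&\,\neg\neg B,\qquad \neg\neg(\neg\neg A\multimap\neg\neg B)\mapsto\neg\neg A\multimap\neg\neg B,\qquad \neg\neg\forall x\,\neg\neg A\mapsto\forall x\,\neg\neg A.$$ Hence $(\cdot)^{\rm lG}$ is a simplification from outside of $(\cdot)^{{\rm K}_o}$ (as translations from $\mathsf{CLL}_{\rm b}$ to $\mathsf{ILL}_\bot$). Moreover, the reductions above are reversible in $\mathsf{ILL}_\bot$ (i.e. the two sides of each reduction are provably equivalent in $\mathsf{ILL}_\bot$).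
   Context: Intuitionistic linear logic $\mathsf{ILL}$ (first order). Formulas are built from atomic formulas, including the constants $1,\top,0$, using $\otimes,\&,\oplus,\multimap$, $\forall x,\exists x$ and $!$. Sequents are $\Gamma\vdash A$ with $\Gamma$ a finite multiset of formulas and exactly one formula on the right. Axioms: $A\vdash A$; $\vdash 1$; $\Gamma\vdash\top$; $\Gamma,0\vdash C$. Rules (premises $\Rightarrow$ conclusion): (cut) $\Gamma\vdash A;\ \Delta,A\vdash C\Rightarrow\Gamma,\Delta\vdash C$; $\Gamma\vdash C\Rightarrow\Gamma,1\vdash C$; $\Gamma\vdash A;\ \Delta\vdash B\Rightarrow\Gamma,\Delta\vdash A\otimes B$; $\Gamma,A,B\vdash C\Rightarrow\Gamma,A\otimes B\vdash C$; $\Gamma,A\vdash B\Rightarrow\Gamma\vdash A\multimap B$; $\Gamma\vdash A;\ \Delta,B\vdash C\Rightarrow\Gamma,\Delta,A\multimap B\vdash C$; $\Gamma\vdash A;\ \Gamma\vdash B\Rightarrow\Gamma\vdash A\& B$; $\Gamma,A\vdash C\Rightarrow\Gamma,A\& B\vdash C$; $\Gamma,B\vdash C\Rightarrow\Gamma,A\& B\vdash C$; $\Gamma\vdash A\Rightarrow\Gamma\vdash A\oplus B$; $\Gamma\vdash B\Rightarrow\Gamma\vdash A\oplus B$; $\Gamma,A\vdash C;\ \Gamma,B\vdash C\Rightarrow\Gamma,A\oplus B\vdash C$; $\Gamma\vdash A\Rightarrow\Gamma\vdash\forall xA$; $\Gamma,A[t/x]\vdash C\Rightarrow\Gamma,\forall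 xA\vdash C$; $\Gamma\vdash A[t/x]\Rightarrow\Gamma\vdash\exists xA$; $\Gamma,A\vdash C\Rightarrow\Gamma,\exists xA\vdash C$ (usual eigenvariable conditions); $\Gamma,!A,!A\vdash C\Rightarrow\Gamma,!A\vdash C$; $\Gamma\vdash C\Rightarrow\Gamma,!A\vdash C$; $!\Gamma\vdash A\Rightarrow\,!\Gamma\vdash\,!A$; $\Gamma,A\vdash C\Rightarrow\Gamma,!A\vdash C$. $\mathsf{ILL}_\bot$ extends $\mathsf{ILL}$ by one more constant $\bot$ (also counted as atomic); its sequents have at most one formula on the right (so $C$ in the rules above may be absent), and it has the additional axiom $\bot\vdash$ and rule $\Gamma\vdash\ \Rightarrow\Gamma\vdash\bot$. $\neg A:=A\multimap\bot$. $\mathsf{DNE}$: $\neg\neg A\vdash A$ (axiom schema). $\mathsf{CLL}_{\rm b}:=\mathsf{ILL}_\bot+\mathsf{DNE}$. Formulas $A,B$ are equivalent over $S$ if $S$ proves $(A\multimap B)\&(B\multimap A)$. Translations. Throughout $\square\in\{\otimes,\&,\oplus,\multimap\}$, $Q\in\{\forall x,\exists x,!\}$. Outer Kolmogorov: $P^{{\rm K}_o}:=\neg\neg P$ ($P$ atomic), $(A\,\square\,B)^{{\rm K}_o}:=\neg\neg(A^{{\rm K}_o}\,\square\,B^{{\rm K}_o})$, $(QA)^{{\rm K}_o}:=\neg\neg QA^{{\rm K}_o}$. Linear Gödel-Gentzen: $P^{\rm lG}:=\neg\neg P$ ($P$ atomic); $(A\otimes B)^{\rm lG}:=\neg\neg(A^{\rm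 lG}\otimes B^{\rm lG})$; $(A\& B)^{\rm lG}:=A^{\rm lG}\& B^{\rm lG}$; $(A\oplus B)^{\rm lG}:=\neg\neg(A^{\rm lG}\oplus B^{\rm lG})$; $(A\multimap B)^{\rm lG}:=A^{\rm lG}\multimap B^{\rm lG}$; $(\forall xA)^{\rm lG}:=\forall xA^{\rm lG}$; $(\exists xA)^{\rm lG}:=\neg\neg\exists xA^{\rm lG}$; $(!A)^{\rm lG}:=\neg\neg\,!A^{\rm lG}$. General notions, for a formula construct $T$ (here $T(A)=\neg\neg A$). A $T$-based outer-transform is $\mathcal T_\square(A,B)=T'(A\,\square\,B)$, resp. $\mathcal T_Q(A)=T'(QA)$, with $T'\in\{T,\mathrm{Id}\}$. A modular outer $T$-translation is one given by outer-transforms via $P^{\rm Tr}:=T(P)$ ($P$ atomic), $(A\,\square\,B)^{\rm Tr}:=\mathcal T^{\rm Tr}_\square(A^{\rm Tr},B^{\rm Tr})$, $(QA)^{\rm Tr}:=\mathcal T^{\rm Tr}_Q(A^{\rm Tr})$. A transform is simpler than another one for the same connective, quantifier or modality if the latter uses $T$ in all places where the former does, but not conversely. A translation is sound from $S_1$ to $S_2$ if for all $A$: $\vdash_{S_1}A$ implies $\vdash_{S_2}A^{\rm Tr}$, and $A$, $A^{\rm Tr}$ are equivalent over $S_1$. Two sound translations from $S_1$ to $S_2$ are equivalent if $A^{\rm Tr}$ and $A^{{\rm Tr}'}$ are equivalent over $S_2$ for all $A$. For equivalent translations, ${\rm Tr}'$ is a simplification of ${\rm Tr}$ if each transform of ${\rm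 Tr}'$ is identical to or simpler than the corresponding one of ${\rm Tr}$, and simpler in at least one case. For two equivalent modular outer $T$-translations, ${\rm Tr}'$ is a simplification from outside of ${\rm Tr}$ if it is a simplification of ${\rm Tr}$ and $A^{{\rm Tr}'}$ is obtained from $A^{\rm Tr}$ by applying the reductions $\mathcal T^{\rm Tr}_\square(T(A),T(B))\mapsto\mathcal T^{{\rm Tr}'}_\square(T(A),T(B))$ and $\mathcal T^{\rm Tr}_Q(T(A))\mapsto\mathcal T^{{\rm Tr}'}_Q(T(A))$ recursively, starting from the whole formula and working towards the atomic formulas (at each stage the reduction matching the current formula, if there is one, is applied to it, and one then continues with the parts $T(A)$, $T(B)$ that are the translations of the immediate subformulas). -}

module Defs where

open import Data.Empty using () renaming (⊥ to Empty)
open import Data.List using (List; []; _∷_; [_]; _++_; map)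
open import Data.List.Relation.Binary.Permutation.Propositional using (_↭_)
open import Data.Maybe as Maybe using (Maybe; just; nothing)
open import Data.Nat using (ℕ; zero; suc)
open import Data.Product using (_×_; ∃)
open import Data.Sum using (_⊎_)
open import Data.Unit using () renaming (⊤ to Unit)
open import Data.Vec using (Vec; []; _∷_)
open import Function using (_∘_)
open import Relation.Binary.PropositionalEquality using (_≡_; refl)
import Relation.Nullary as Meta

record Signature : Set₁ where
  field
    Fun      : Set
    funArity : Fun → ℕ
    Rel      : Set
    relArity : Rel → ℕ

module LinearLogic (𝓛 : Signature) where
  open Signature 𝓛

  -- De Bruijn indices. They are not bounded by a scope, so that, as with named
  -- variables, there is always a supply of free variables (and hence of terms,
  -- even when the signature has no constants).
  data Term : Set where
    var : ℕ → Term
    fun : (f : Fun) → Vec Term (funArity f) → Term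

  data Atom : Set where
    rel              : (R : Rel) → Vec Term (relArity R) → Atom
    one top nil bot  : Atom

  data Binary : Set where
    tensor with′ plus lolli : Binary

  data Unary : Set where
    all ex bang : Unary

  -- `un all A` and `un ex A` bind index 0 in A; `un bang A` binds nothing.
  data Formula : Set where
    atom : Atom → Formula
    bin  : Binary → Formula → Formula → Formula
    un   : Unary → Formula → Formula

  infixr 7 _⊗_ _&_
  infixr 6 _⊕_
  infixr 5 _⊸_
  infix  8 ¬_ ¬¬_ !_ ∀′_ ∃′_

  pattern 𝟏 = atom one
  pattern ⊤ = atom top
  pattern 𝟎 = atom nil
  pattern ⊥ = atom bot
  pattern _⊗_ A B = bin tensor A B
  pattern _&_ A B = bin with′ A B
  pattern _⊕_ A B = bin plus A B
  pattern _⊸_ A B = bin lolli A B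
  pattern ∀′_ A = un all A
  pattern ∃′_ A = un ex A
  pattern !_ A = un bang A
  pattern ¬_ A = A ⊸ ⊥
  pattern ¬¬_ A = ¬ (¬ A)

  Subst : Set
  Subst = ℕ → Term

  substTerm  : Subst → Term → Term
  substTerms : ∀ {n} → Subst → Vec Term n → Vec Term n
  substTerm σ (var x)    = σ x
  substTerm σ (fun f ts) = fun f (substTerms σ ts)
  substTerms σ []       = []
  substTerms σ (t ∷ ts) = substTerm σ t ∷ substTerms σ ts

  shift : Subst
  shift = var ∘ suc

  lift : Subst → Subst
  lift σ zero    = var zero
  lift σ (suc x) = substTerm shift (σ x)

  under : Unary → Subst → Subst
  under all  = lift
  under ex   = lift
  under bang = λ σ → σ

  substAtom : Subst → Atom → Atom
  substAtom σ (rel R ts) = rel R (substTerms σ ts)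
  substAtom σ one        = one
  substAtom σ top        = top
  substAtom σ nil        = nil
  substAtom σ bot        = bot

  subst : Subst → Formula → Formula
  subst σ (atom P)    = atom (substAtom σ P)
  subst σ (bin □ A B) = bin □ (subst σ A) (subst σ B)
  subst σ (un Q A)    = un Q (subst (under Q σ) A)

  instantiate : Term → Subst
  instantiate t zero    = t
  instantiate t (suc x) = var x

  _[_/0] : Formula → Term → Formula
  A [ t /0] = subst (instantiate t) A

  ↑ : Formula → Formula
  ↑ = subst shift

  -- A theory is given by the axioms it adds to those of ILL⊥.
  Theory : Set₁
  Theory = List Formula → Maybe Formula → Set

  -- Multisets are lists up to the exchange rule. The eigenvariable conditions
  -- of ∀R and ∃L are expressed by shifting the side formulas.
  infix 3 _∣_⊢_
  data _∣_⊢_ (S : Theory) : List Formula → Maybe Formula → Set where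
    extra    : ∀ {Γ C} → S Γ C → S ∣ Γ ⊢ C
    exchange : ∀ {Γ Δ C} → Γ ↭ Δ → S ∣ Γ ⊢ C → S ∣ Δ ⊢ C
    ax       : ∀ {A} → S ∣ [ A ] ⊢ just A
    cut      : ∀ {Γ Δ A C} → S ∣ Γ ⊢ just A → S ∣ A ∷ Δ ⊢ C → S ∣ Γ ++ Δ ⊢ C
    𝟏R       : S ∣ [] ⊢ just 𝟏
    𝟏L       : ∀ {Γ C} → S ∣ Γ ⊢ C → S ∣ 𝟏 ∷ Γ ⊢ C
    ⊤R       : ∀ {Γ} → S ∣ Γ ⊢ just ⊤
    𝟎L       : ∀ {Γ C} → S ∣ 𝟎 ∷ Γ ⊢ C
    ⊥L       : S ∣ [ ⊥ ] ⊢ nothing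
    ⊥R       : ∀ {Γ} → S ∣ Γ ⊢ nothing → S ∣ Γ ⊢ just ⊥
    ⊗R       : ∀ {Γ Δ A B} → S ∣ Γ ⊢ just A → S ∣ Δ ⊢ just B → S ∣ Γ ++ Δ ⊢ just (A ⊗ B)
    ⊗L       : ∀ {Γ A B C} → S ∣ A ∷ B ∷ Γ ⊢ C → S ∣ A ⊗ B ∷ Γ ⊢ C
    ⊸R       : ∀ {Γ A B} → S ∣ A ∷ Γ ⊢ just B → S ∣ Γ ⊢ just (A ⊸ B)
    ⊸L       : ∀ {Γ Δ A B C} → S ∣ Γ ⊢ just A → S ∣ B ∷ Δ ⊢ C → S ∣ (A ⊸ B) ∷ Γ ++ Δ ⊢ C
    &R       : ∀ {Γ A B} → S ∣ Γ ⊢ just A → S ∣ Γ ⊢ just B → S ∣ Γ ⊢ just (A & B)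
    &L₁      : ∀ {Γ A B C} → S ∣ A ∷ Γ ⊢ C → S ∣ A & B ∷ Γ ⊢ C
    &L₂      : ∀ {Γ A B C} → S ∣ B ∷ Γ ⊢ C → S ∣ A & B ∷ Γ ⊢ C
    ⊕R₁      : ∀ {Γ A B} → S ∣ Γ ⊢ just A → S ∣ Γ ⊢ just (A ⊕ B)
    ⊕R₂      : ∀ {Γ A B} → S ∣ Γ ⊢ just B → S ∣ Γ ⊢ just (A ⊕ B)
    ⊕L       : ∀ {Γ A B C} → S ∣ A ∷ Γ ⊢ C → S ∣ B ∷ Γ ⊢ C → S ∣ A ⊕ B ∷ Γ ⊢ C
    ∀R       : ∀ {Γ A} → S ∣ map ↑ Γ ⊢ just A → S ∣ Γ ⊢ just (∀′ A)
    ∀L       : ∀ {Γ A C} (t : Term) → S ∣ A [ t /0] ∷ Γ ⊢ C → S ∣ ∀′ A ∷ Γ ⊢ C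
    ∃R       : ∀ {Γ A} (t : Term) → S ∣ Γ ⊢ just (A [ t /0]) → S ∣ Γ ⊢ just (∃′ A)
    ∃L       : ∀ {Γ A C} → S ∣ A ∷ map ↑ Γ ⊢ Maybe.map ↑ C → S ∣ ∃′ A ∷ Γ ⊢ C
    !C       : ∀ {Γ A C} → S ∣ ! A ∷ ! A ∷ Γ ⊢ C → S ∣ ! A ∷ Γ ⊢ C
    !W       : ∀ {Γ A C} → S ∣ Γ ⊢ C → S ∣ ! A ∷ Γ ⊢ C
    !R       : ∀ {Γ A} → S ∣ map !_ Γ ⊢ just A → S ∣ map !_ Γ ⊢ just (! A)
    !L       : ∀ {Γ A C} → S ∣ A ∷ Γ ⊢ C → S ∣ ! A ∷ Γ ⊢ C

  data DNE : Theory where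
    dne : ∀ {A} → DNE [ ¬¬ A ] (just A)

  ILL⊥ CLLb : Theory
  ILL⊥ _ _ = Empty
  CLLb     = DNE

  infix 3 _⊢_ _⊢_⇔_
  _⊢_ : Theory → Formula → Set
  S ⊢ A = S ∣ [] ⊢ just A

  _⊢_⇔_ : Theory → Formula → Formula → Set
  S ⊢ A ⇔ B = S ⊢ (A ⊸ B) & (B ⊸ A)

  Translation : Set
  Translation = Formula → Formula

  record Sound (S₁ S₂ : Theory) (tr : Translation) : Set where
    field
      preserves  : ∀ A → S₁ ⊢ A → S₂ ⊢ tr A
      equivalent : ∀ A → S₁ ⊢ A ⇔ tr A

  record Equivalent (S₁ S₂ : Theory) (tr′ tr : Translation) : Set where
    field
      sound′     : Sound S₁ S₂ tr′
      sound      : Sound S₁ S₂ tr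
      equivalent : ∀ A → S₂ ⊢ tr A ⇔ tr′ A

  -- The choice of T′ ∈ {T, Id}: an outer-transform has one place for T.
  data Outer : Set where
    useT useId : Outer

  UsesT : Outer → Set
  UsesT useT  = Unit
  UsesT useId = Empty

  Simpler : Outer → Outer → Set
  Simpler t′ t = (UsesT t′ → UsesT t) × (Meta.¬ (UsesT t → UsesT t′))

  IdenticalOrSimpler : Outer → Outer → Set
  IdenticalOrSimpler t′ t = t′ ≡ t ⊎ Simpler t′ t

  module Modular (T : Formula → Formula) where

    applyOuter : Outer → Formula → Formula
    applyOuter useT  A = T A
    applyOuter useId A = A

    record ModularOuterTranslation : Set where
      field
        tr       : Translation
        outerBin : Binary → Outer
        outerUn  : Unary → Outer

      𝒯bin : Binary → Formula → Formula → Formula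
      𝒯bin □ A B = applyOuter (outerBin □) (bin □ A B)

      𝒯un : Unary → Formula → Formula
      𝒯un Q A = applyOuter (outerUn Q) (un Q A)

      field
        tr-atom : ∀ P → tr (atom P) ≡ T (atom P)
        tr-bin  : ∀ □ A B → tr (bin □ A B) ≡ 𝒯bin □ (tr A) (tr B)
        tr-un   : ∀ Q A → tr (un Q A) ≡ 𝒯un Q (tr A)

    record Simplification (S₁ S₂ : Theory) (Tr′ Tr : ModularOuterTranslation) : Set where
      private
        module Tr′ = ModularOuterTranslation Tr′
        module Tr  = ModularOuterTranslation Tr
      field
        equivalent : Equivalent S₁ S₂ Tr′.tr Tr.tr
        binary     : ∀ □ → IdenticalOrSimpler (Tr′.outerBin □) (Tr.outerBin □)
        unary      : ∀ Q → IdenticalOrSimpler (Tr′.outerUn Q) (Tr.outerUn Q)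
        somewhere  : (∃ λ □ → Simpler (Tr′.outerBin □) (Tr.outerBin □))
                   ⊎ (∃ λ Q → Simpler (Tr′.outerUn Q) (Tr.outerUn Q))

    module _ (Tr′ Tr : ModularOuterTranslation) where
      private
        module Tr′ = ModularOuterTranslation Tr′
        module Tr  = ModularOuterTranslation Tr

      data Reduction : Formula → Formula → Set where
        bin : ∀ □ A B → Reduction (Tr.𝒯bin □ (T A) (T B)) (Tr′.𝒯bin □ (T A) (T B))
        un  : ∀ Q A → Reduction (Tr.𝒯un Q (T A)) (Tr′.𝒯un Q (T A))

      -- `reduce-bin` and `reduce-un` perform a `Reduction` on the whole formula
      -- and then continue with the parts T A, T B of its result.
      data ReducesFromOutside : Formula → Formula → Set where
        stop       : ∀ {X} → (∀ {Y} → Meta.¬ Reduction X Y) → ReducesFromOutside X X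
        reduce-bin : ∀ □ {A B A′ B′} →
                     ReducesFromOutside (T A) A′ → ReducesFromOutside (T B) B′ →
                     ReducesFromOutside (Tr.𝒯bin □ (T A) (T B)) (Tr′.𝒯bin □ A′ B′)
        reduce-un  : ∀ Q {A A′} →
                     ReducesFromOutside (T A) A′ →
                     ReducesFromOutside (Tr.𝒯un Q (T A)) (Tr′.𝒯un Q A′)

    record SimplificationFromOutside (S₁ S₂ : Theory) (Tr′ Tr : ModularOuterTranslation) : Set where
      private
        module Tr′ = ModularOuterTranslation Tr′
        module Tr  = ModularOuterTranslation Tr
      field
        simplification : Simplification S₁ S₂ Tr′ Tr
        fromOutside    : ∀ A → ReducesFromOutside Tr′ Tr (Tr.tr A) (Tr′.tr A)

  infix 9 _ᴷᵒ _ˡᴳ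

  _ᴷᵒ : Translation
  (atom P) ᴷᵒ    = ¬¬ (atom P)
  (bin □ A B) ᴷᵒ = ¬¬ (bin □ (A ᴷᵒ) (B ᴷᵒ))
  (un Q A) ᴷᵒ    = ¬¬ (un Q (A ᴷᵒ))

  _ˡᴳ : Translation
  (atom P) ˡᴳ = ¬¬ (atom P)
  (A ⊗ B) ˡᴳ  = ¬¬ (A ˡᴳ ⊗ B ˡᴳ)
  (A & B) ˡᴳ  = A ˡᴳ & B ˡᴳ
  (A ⊕ B) ˡᴳ  = ¬¬ (A ˡᴳ ⊕ B ˡᴳ)
  (A ⊸ B) ˡᴳ  = A ˡᴳ ⊸ B ˡᴳ
  (∀′ A) ˡᴳ   = ∀′ (A ˡᴳ)
  (∃′ A) ˡᴳ   = ¬¬ (∃′ (A ˡᴳ))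
  (! A) ˡᴳ    = ¬¬ (! (A ˡᴳ))

  doubleNegation : Formula → Formula
  doubleNegation A = ¬¬ A

  open Modular doubleNegation public

  outerKolmogorov : ModularOuterTranslation
  outerKolmogorov = record
    { tr       = _ᴷᵒ
    ; outerBin = λ _ → useT
    ; outerUn  = λ _ → useT
    ; tr-atom  = λ _ → refl
    ; tr-bin   = λ _ _ _ → refl
    ; tr-un    = λ _ _ → refl
    }

  linearGödelGentzen : ModularOuterTranslation
  linearGödelGentzen = record
    { tr       = _ˡᴳ
    ; outerBin = λ { tensor → useT ; with′ → useId ; plus → useT ; lolli → useId }
    ; outerUn  = λ { all → useId ; ex → useT ; bang → useT }
    ; tr-atom  = λ _ → refl
    ; tr-bin   = λ { tensor _ _ → refl ; with′ _ _ → refl ; plus _ _ → refl ; lolli _ _ → refl }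
    ; tr-un    = λ { all _ → refl ; ex _ → refl ; bang _ → refl }
    }

  infix 3 _↦_ _↠_ _↠ₛ_

  data _↦_ : Formula → Formula → Set where
    &-reduction : ∀ {A B} → ¬¬ (¬¬ A & ¬¬ B) ↦ ¬¬ A & ¬¬ B
    ⊸-reduction : ∀ {A B} → ¬¬ (¬¬ A ⊸ ¬¬ B) ↦ ¬¬ A ⊸ ¬¬ B
    ∀-reduction : ∀ {A} → ¬¬ (∀′ (¬¬ A)) ↦ ∀′ (¬¬ A)

  -- X ↠ Y: apply to X the reduction that matches it, if there is one, and then
  -- treat the immediate subformulas of the result in the same way (↠ₛ).
  data _↠_ : Formula → Formula → Set
  data _↠ₛ_ : Formula → Formula → Set

  data _↠_ where
    reduce : ∀ {X X′ Y} → X ↦ X′ → X′ ↠ₛ Y → X ↠ Y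
    keep   : ∀ {X Y} → (∀ {X′} → Meta.¬ (X ↦ X′)) → X ↠ₛ Y → X ↠ Y

  data _↠ₛ_ where
    atom : ∀ {P} → atom P ↠ₛ atom P
    bin  : ∀ {□ A B A′ B′} → A ↠ A′ → B ↠ B′ → bin □ A B ↠ₛ bin □ A′ B′
    un   : ∀ {Q A A′} → A ↠ A′ → un Q A ↠ₛ un Q A′

{-# OPTIONS --safe #-}
-- A double negation on the left may be removed as soon as the right-hand side
-- is stable, i.e. follows from its own double negation. Stability passes from B
-- to A ⊸ B, from A and B to A & B and from A to ∀′ A; this gives the reductions
-- and the stability of every A ˡᴳ, hence A ᴷᵒ ⇔ A ˡᴳ. The translation by _ˡᴳ of a
-- CLLb derivation is an induction in which stability handles the left rules of
-- the connectives that carry a double negation; the soundness of _ᴷᵒ is then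
-- inherited through the equivalence.
module Submission where

open import Defs
open import Data.List using (List; []; _∷_; [_]; _++_; map)
open import Data.List.Properties using (++-identityʳ; map-++; map-∘; map-cong)
open import Data.List.Relation.Binary.Permutation.Propositional
  using (↭-refl; ↭-sym; swap)
open import Data.List.Relation.Binary.Permutation.Propositional.Properties
  using (map⁺) renaming (shift to ↭-shift)
open import Data.Maybe as Maybe using (Maybe; just; nothing)
open import Data.Nat using (zero; suc)
open import Data.Product as Product using (_×_; _,_; ∃; proj₁; proj₂)
open import Data.Sum using (inj₁; inj₂)
open import Data.Vec using (Vec; []; _∷_)
open import Relation.Binary.PropositionalEquality as ≡
  using (_≡_; refl; sym; trans; cong; cong₂)
import Relation.Nullary as Meta

module _ {𝓛 : Signature} where
  open LinearLogic 𝓛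

  -- Substitutions undone by another substitution.

  -- Requiring σ to be a renaming makes the relation stable under lift without a
  -- composition law for substitutions.
  Retracts : Subst → Subst → Set
  Retracts τ σ = ∀ x → ∃ λ y → σ x ≡ var y × τ y ≡ var x

  lift-retracts : ∀ {τ σ} → Retracts τ σ → Retracts (lift τ) (lift σ)
  lift-retracts r zero    = zero , refl , refl
  lift-retracts r (suc x) with r x
  ... | y , σx , τy = suc y , cong (substTerm shift) σx , cong (substTerm shift) τy

  under-retracts : ∀ Q {τ σ} → Retracts τ σ → Retracts (under Q τ) (under Q σ)
  under-retracts all  = lift-retracts
  under-retracts ex   = lift-retracts
  under-retracts bang = λ r → r

  retract-term  : ∀ {τ σ} → Retracts τ σ → ∀ t → substTerm τ (substTerm σ t) ≡ t
  retract-terms : ∀ {τ σ n} → Retracts τ σ → (ts : Vec Term n) →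
                  substTerms τ (substTerms σ ts) ≡ ts
  retract-term {τ} r (var x) with r x
  ... | _ , σx , τy = trans (cong (substTerm τ) σx) τy
  retract-term r (fun f ts) = cong (fun f) (retract-terms r ts)
  retract-terms r []       = refl
  retract-terms r (t ∷ ts) = cong₂ _∷_ (retract-term r t) (retract-terms r ts)

  retract-atom : ∀ {τ σ} → Retracts τ σ → ∀ P → substAtom τ (substAtom σ P) ≡ P
  retract-atom r (rel R ts) = cong (rel R) (retract-terms r ts)
  retract-atom r one        = refl
  retract-atom r top        = refl
  retract-atom r nil        = refl
  retract-atom r bot        = refl

  retract : ∀ {τ σ} → Retracts τ σ → ∀ A → subst τ (subst σ A) ≡ A
  retract r (atom P)    = cong atom (retract-atom r P)
  retract r (bin □ A B) = cong₂ (bin □) (retract r A) (retract r B)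
  retract r (un Q A)    = cong (un Q) (retract (under-retracts Q r) A)

  -- `lift shift` fixes index 0 and skips index 1; instantiating 0 by itself closes that gap.
  instantiate-lift-shift : ∀ A → subst (lift shift) A [ var zero /0] ≡ A
  instantiate-lift-shift = retract λ { zero    → zero , refl , refl
                                     ; (suc x) → suc (suc x) , refl , refl }

  -- Derived rules and stability over an arbitrary theory.

  module _ {S : Theory} where

    infixl 4 _⟫_
    _⟫_ : ∀ {Γ A C} → S ∣ Γ ⊢ just A → S ∣ [ A ] ⊢ C → S ∣ Γ ⊢ C
    _⟫_ {Γ} {C = C} d e = ≡.subst (S ∣_⊢ C) (++-identityʳ Γ) (cut d e)

    swapL : ∀ {Γ A B C} → S ∣ A ∷ B ∷ Γ ⊢ C → S ∣ B ∷ A ∷ Γ ⊢ C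
    swapL = exchange (swap _ _ ↭-refl)

    -- Left rules act on the head only, so each treated formula is moved behind the untreated ones,
    -- into `Δ`.
    replaceL : ∀ {f g : Formula → Formula} {C} →
               (∀ {A Δ} → S ∣ f A ∷ Δ ⊢ C → S ∣ g A ∷ Δ ⊢ C) →
               ∀ Γ Δ → S ∣ map f Γ ++ Δ ⊢ C → S ∣ map g Γ ++ Δ ⊢ C
    replaceL         h []      Δ d = d
    replaceL {f} {g} h (A ∷ Γ) Δ d =
      exchange (↭-shift (g A) (map g Γ) Δ)
        (replaceL h Γ (g A ∷ Δ)
          (exchange (↭-sym (↭-shift (g A) (map f Γ) Δ)) (h d)))

    replaceAllL : ∀ {f g : Formula → Formula} {C} →
                  (∀ {A Δ} → S ∣ f A ∷ Δ ⊢ C → S ∣ g A ∷ Δ ⊢ C) →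
                  ∀ Γ → S ∣ map f Γ ⊢ C → S ∣ map g Γ ⊢ C
    replaceAllL {f} {g} {C} h Γ d =
      ≡.subst (S ∣_⊢ C) (++-identityʳ (map g Γ))
        (replaceL h Γ [] (≡.subst (S ∣_⊢ C) (sym (++-identityʳ (map f Γ))) d))

    ¬R : ∀ {Γ A} → S ∣ A ∷ Γ ⊢ nothing → S ∣ Γ ⊢ just (¬ A)
    ¬R d = ⊸R (⊥R d)

    ¬L : ∀ {Γ A} → S ∣ Γ ⊢ just A → S ∣ ¬ A ∷ Γ ⊢ nothing
    ¬L {Γ} {A} d = ≡.subst (λ Δ → S ∣ ¬ A ∷ Δ ⊢ nothing) (++-identityʳ Γ) (⊸L d ⊥L)

    ¬¬R : ∀ {Γ A} → S ∣ Γ ⊢ just A → S ∣ Γ ⊢ just (¬¬ A)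
    ¬¬R d = ¬R (¬L d)

    Stable : Formula → Set
    Stable A = S ∣ [ ¬¬ A ] ⊢ just A

    ¬¬L₀ : ∀ {Γ A} → S ∣ A ∷ Γ ⊢ nothing → S ∣ ¬¬ A ∷ Γ ⊢ nothing
    ¬¬L₀ d = ¬L (¬R d)

    -- Moving `C` to the left as `¬ C` empties the right-hand side, where `¬¬L₀` applies; stability
    -- then turns the resulting `¬¬ C` into `C`.
    ¬¬L : ∀ {Γ A C} → Stable C → S ∣ A ∷ Γ ⊢ just C → S ∣ ¬¬ A ∷ Γ ⊢ just C
    ¬¬L s d = ¬R (swapL (¬¬L₀ (swapL (¬L d)))) ⟫ s

    stable-⊥ : Stable ⊥
    stable-⊥ = ⊥R (¬¬L₀ ⊥L)

    stable-& : ∀ {A B} → Stable A → Stable B → Stable (A & B)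
    stable-& s t = &R (¬¬L s (&L₁ ax)) (¬¬L t (&L₂ ax))

    stable-⊸ : ∀ {A B} → Stable B → Stable (A ⊸ B)
    stable-⊸ s = ⊸R (swapL (¬¬L s (⊸L ax ax)))

    -- A formula that begins with `¬¬` is itself a negation, so this covers the clauses of `_ˡᴳ`
    -- that keep a double negation and the parts of each redex.
    stable-¬ : ∀ {A} → Stable (¬ A)
    stable-¬ = stable-⊸ stable-⊥

    -- In the context shifted by `∀R`, index 0 is the eigenvariable, and the quantifier is
    -- instantiated at it.
    ∀L-bound : ∀ {A} → S ∣ [ ↑ (∀′ A) ] ⊢ just A
    ∀L-bound {A} =
      ∀L (var zero) (≡.subst (λ B → S ∣ [ B ] ⊢ just A) (sym (instantiate-lift-shift A)) ax)

    ∃R-bound : ∀ {A} → S ∣ [ A ] ⊢ just (↑ (∃′ A))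
    ∃R-bound {A} =
      ∃R (var zero) (≡.subst (λ B → S ∣ [ A ] ⊢ just B) (sym (instantiate-lift-shift A)) ax)

    stable-∀ : ∀ {A} → Stable A → Stable (∀′ A)
    stable-∀ s = ∀R (¬¬L s ∀L-bound)

    stable-ˡᴳ : ∀ A → Stable (A ˡᴳ)
    stable-ˡᴳ (atom P) = stable-¬
    stable-ˡᴳ (A ⊗ B)  = stable-¬
    stable-ˡᴳ (A & B)  = stable-& (stable-ˡᴳ A) (stable-ˡᴳ B)
    stable-ˡᴳ (A ⊕ B)  = stable-¬
    stable-ˡᴳ (A ⊸ B)  = stable-⊸ (stable-ˡᴳ B)
    stable-ˡᴳ (∀′ A)   = stable-∀ (stable-ˡᴳ A)
    stable-ˡᴳ (∃′ A)   = stable-¬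
    stable-ˡᴳ (! A)    = stable-¬

    -- Interderivability and congruence.

    infix 3 _⊣⊢_
    _⊣⊢_ : Formula → Formula → Set
    A ⊣⊢ B = (S ∣ [ A ] ⊢ just B) × (S ∣ [ B ] ⊢ just A)

    ⊣⊢-refl : ∀ {A} → A ⊣⊢ A
    ⊣⊢-refl = ax , ax

    ⊣⊢-sym : ∀ {A B} → A ⊣⊢ B → B ⊣⊢ A
    ⊣⊢-sym = Product.swap

    ⊣⊢-trans : ∀ {A B C} → A ⊣⊢ B → B ⊣⊢ C → A ⊣⊢ C
    ⊣⊢-trans (d , d′) (e , e′) = (d ⟫ e) , (e′ ⟫ d′)

    ⊣⊢⇒⇔ : ∀ {A B} → A ⊣⊢ B → S ⊢ A ⇔ B
    ⊣⊢⇒⇔ (d , e) = &R (⊸R d) (⊸R e)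

    stable⇒⊣⊢ : ∀ {A} → Stable A → ¬¬ A ⊣⊢ A
    stable⇒⊣⊢ s = s , ¬¬R ax

    -- Both directions are assumed because `⊸` reverses its first argument.
    bin-mono : ∀ □ {A A′ B B′} → A ⊣⊢ A′ → B ⊣⊢ B′ → S ∣ [ bin □ A B ] ⊢ just (bin □ A′ B′)
    bin-mono tensor (a , _) (b , _) = ⊗L (⊗R a b)
    bin-mono with′  (a , _) (b , _) = &R (&L₁ a) (&L₂ b)
    bin-mono plus   (a , _) (b , _) = ⊕L (⊕R₁ a) (⊕R₂ b)
    bin-mono lolli  (_ , a) (b , _) = ⊸R (swapL (⊸L a b))

    bin-cong : ∀ □ {A A′ B B′} → A ⊣⊢ A′ → B ⊣⊢ B′ → bin □ A B ⊣⊢ bin □ A′ B′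
    bin-cong □ p q = bin-mono □ p q , bin-mono □ (⊣⊢-sym p) (⊣⊢-sym q)

    un-mono : ∀ Q {A A′} → S ∣ [ A ] ⊢ just A′ → S ∣ [ un Q A ] ⊢ just (un Q A′)
    un-mono all  a = ∀R (∀L-bound ⟫ a)
    un-mono ex   a = ∃L (a ⟫ ∃R-bound)
    un-mono bang {A} a = !R {Γ = [ A ]} (!L a)

    un-cong : ∀ Q {A A′} → A ⊣⊢ A′ → un Q A ⊣⊢ un Q A′
    un-cong Q (a , a′) = un-mono Q a , un-mono Q a′

    ¬¬-cong : ∀ {A B} → A ⊣⊢ B → ¬¬ A ⊣⊢ ¬¬ B
    ¬¬-cong p = bin-cong lolli (bin-cong lolli p ⊣⊢-refl) ⊣⊢-refl

    -- Congruence works below the outer double negation; where `_ˡᴳ` has none, stability of the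
    -- translated formula removes it.
    ᴷᵒ⊣⊢ˡᴳ : ∀ A → A ᴷᵒ ⊣⊢ A ˡᴳ
    ᴷᵒ⊣⊢ˡᴳ-bin : ∀ □ A B → bin □ (A ᴷᵒ) (B ᴷᵒ) ⊣⊢ bin □ (A ˡᴳ) (B ˡᴳ)
    ᴷᵒ⊣⊢ˡᴳ-un : ∀ Q A → un Q (A ᴷᵒ) ⊣⊢ un Q (A ˡᴳ)

    ᴷᵒ⊣⊢ˡᴳ (atom P) = ⊣⊢-refl
    ᴷᵒ⊣⊢ˡᴳ (A ⊗ B)  = ¬¬-cong (ᴷᵒ⊣⊢ˡᴳ-bin tensor A B)
    ᴷᵒ⊣⊢ˡᴳ (A & B)  = ⊣⊢-trans (¬¬-cong (ᴷᵒ⊣⊢ˡᴳ-bin with′ A B)) (stable⇒⊣⊢ (stable-ˡᴳ (A & B)))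
    ᴷᵒ⊣⊢ˡᴳ (A ⊕ B)  = ¬¬-cong (ᴷᵒ⊣⊢ˡᴳ-bin plus A B)
    ᴷᵒ⊣⊢ˡᴳ (A ⊸ B)  = ⊣⊢-trans (¬¬-cong (ᴷᵒ⊣⊢ˡᴳ-bin lolli A B)) (stable⇒⊣⊢ (stable-ˡᴳ (A ⊸ B)))
    ᴷᵒ⊣⊢ˡᴳ (∀′ A)   = ⊣⊢-trans (¬¬-cong (ᴷᵒ⊣⊢ˡᴳ-un all A)) (stable⇒⊣⊢ (stable-ˡᴳ (∀′ A)))
    ᴷᵒ⊣⊢ˡᴳ (∃′ A)   = ¬¬-cong (ᴷᵒ⊣⊢ˡᴳ-un ex A)
    ᴷᵒ⊣⊢ˡᴳ (! A)    = ¬¬-cong (ᴷᵒ⊣⊢ˡᴳ-un bang A)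

    ᴷᵒ⊣⊢ˡᴳ-bin □ A B = bin-cong □ (ᴷᵒ⊣⊢ˡᴳ A) (ᴷᵒ⊣⊢ˡᴳ B)
    ᴷᵒ⊣⊢ˡᴳ-un Q A = un-cong Q (ᴷᵒ⊣⊢ˡᴳ A)

    reversible : ∀ {X Y} → X ↦ Y → X ⊣⊢ Y
    reversible &-reduction = stable⇒⊣⊢ (stable-& stable-¬ stable-¬)
    reversible ⊸-reduction = stable⇒⊣⊢ (stable-⊸ stable-¬)
    reversible ∀-reduction = stable⇒⊣⊢ (stable-∀ stable-¬)

  dne⊣⊢ : ∀ {A} → _⊣⊢_ {CLLb} (¬¬ A) A
  dne⊣⊢ = stable⇒⊣⊢ (extra dne)

  ᴷᵒ⊣⊢id : ∀ A → _⊣⊢_ {CLLb} (A ᴷᵒ) A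
  ᴷᵒ⊣⊢id (atom P)    = dne⊣⊢
  ᴷᵒ⊣⊢id (bin □ A B) = ⊣⊢-trans dne⊣⊢ (bin-cong □ (ᴷᵒ⊣⊢id A) (ᴷᵒ⊣⊢id B))
  ᴷᵒ⊣⊢id (un Q A)    = ⊣⊢-trans dne⊣⊢ (un-cong Q (ᴷᵒ⊣⊢id A))

  -- Translating derivations, beginning with compatibility with substitution.

  ˡᴳ-subst : ∀ σ A → subst σ A ˡᴳ ≡ subst σ (A ˡᴳ)
  ˡᴳ-subst σ (atom P) = refl
  ˡᴳ-subst σ (A ⊗ B)  = cong doubleNegation (cong₂ _⊗_ (ˡᴳ-subst σ A) (ˡᴳ-subst σ B))
  ˡᴳ-subst σ (A & B)  = cong₂ _&_ (ˡᴳ-subst σ A) (ˡᴳ-subst σ B)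
  ˡᴳ-subst σ (A ⊕ B)  = cong doubleNegation (cong₂ _⊕_ (ˡᴳ-subst σ A) (ˡᴳ-subst σ B))
  ˡᴳ-subst σ (A ⊸ B)  = cong₂ _⊸_ (ˡᴳ-subst σ A) (ˡᴳ-subst σ B)
  ˡᴳ-subst σ (∀′ A)   = cong ∀′_ (ˡᴳ-subst (lift σ) A)
  ˡᴳ-subst σ (∃′ A)   = cong (λ B → ¬¬ (∃′ B)) (ˡᴳ-subst (lift σ) A)
  ˡᴳ-subst σ (! A)    = cong (λ B → ¬¬ (! B)) (ˡᴳ-subst σ A)

  map-ˡᴳ-↑ : ∀ Γ → map _ˡᴳ (map ↑ Γ) ≡ map ↑ (map _ˡᴳ Γ)
  map-ˡᴳ-↑ Γ = trans (sym (map-∘ Γ)) (trans (map-cong (ˡᴳ-subst shift) Γ) (map-∘ Γ))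

  maybe-ˡᴳ-↑ : ∀ C → Maybe.map _ˡᴳ (Maybe.map ↑ C) ≡ Maybe.map ↑ (Maybe.map _ˡᴳ C)
  maybe-ˡᴳ-↑ nothing  = refl
  maybe-ˡᴳ-↑ (just C) = cong just (ˡᴳ-subst shift C)

  module _ {S : Theory} where

    infix 3 _⊢ˡᴳ_
    _⊢ˡᴳ_ : List Formula → Maybe Formula → Set
    Γ ⊢ˡᴳ C = S ∣ map _ˡᴳ Γ ⊢ Maybe.map _ˡᴳ C

    ¬¬L-ˡᴳ : ∀ C {Γ A} → S ∣ A ∷ Γ ⊢ Maybe.map _ˡᴳ C → S ∣ ¬¬ A ∷ Γ ⊢ Maybe.map _ˡᴳ C
    ¬¬L-ˡᴳ nothing  = ¬¬L₀
    ¬¬L-ˡᴳ (just C) = ¬¬L (stable-ˡᴳ C)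

    join : ∀ Γ {Δ C} → S ∣ map _ˡᴳ Γ ++ map _ˡᴳ Δ ⊢ C → S ∣ map _ˡᴳ (Γ ++ Δ) ⊢ C
    join Γ {Δ} {C} = ≡.subst (S ∣_⊢ C) (sym (map-++ _ˡᴳ Γ Δ))

    -- Promotion needs a context of `!` formulas, but the translated one consists of formulas
    -- `¬¬ (! G ˡᴳ)`. Cuts with `¬¬R ax` first replace these by `! G ˡᴳ`; after promotion the goal
    -- becomes a negation, hence stable, and `¬¬L` restores the context.
    !R-ˡᴳ : ∀ Γ {A} → map !_ Γ ⊢ˡᴳ just A → map !_ Γ ⊢ˡᴳ just (! A)
    !R-ˡᴳ Γ {A} d =
      ≡.subst (S ∣_⊢ just (¬¬ (! A ˡᴳ))) (map-∘ Γ)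
        (replaceAllL (¬¬L stable-¬) Γ (¬¬R (!R-map
          (replaceAllL (cut (¬¬R ax)) Γ
            (≡.subst (S ∣_⊢ just (A ˡᴳ)) (sym (map-∘ Γ)) d)))))
      where
      !R-map : ∀ {B} → S ∣ map (λ G → ! G ˡᴳ) Γ ⊢ just B → S ∣ map (λ G → ! G ˡᴳ) Γ ⊢ just (! B)
      !R-map {B} e =
        ≡.subst (S ∣_⊢ just (! B)) (sym (map-∘ Γ))
          (!R {Γ = map _ˡᴳ Γ} (≡.subst (S ∣_⊢ just B) (map-∘ Γ) e))

    -- Only the rules common to all theories are used in the result, so the target `S` is arbitrary.
    translate : ∀ {Γ C} → CLLb ∣ Γ ⊢ C → Γ ⊢ˡᴳ C
    -- The atom `⊥` is itself translated to `¬¬ ⊥`; stability of `⊥` collapses both occurrences,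
    -- leaving `¬¬ (A ˡᴳ)`.
    translate (extra (dne {A})) =
      bin-mono lolli (bin-cong lolli ⊣⊢-refl (stable⇒⊣⊢ stable-⊥)) (stable⇒⊣⊢ stable-⊥)
        ⟫ stable-ˡᴳ A
    translate (exchange p d)    = exchange (map⁺ _ˡᴳ p) (translate d)
    translate ax                = ax
    translate (cut {Γ} d e)     = join Γ (cut (translate d) (translate e))
    translate 𝟏R                = ¬¬R 𝟏R
    translate (𝟏L {C = C} d)    = ¬¬L-ˡᴳ C (𝟏L (translate d))
    translate ⊤R                = ¬¬R ⊤R
    translate (𝟎L {C = C})      = ¬¬L-ˡᴳ C 𝟎L
    translate ⊥L                = ¬¬L₀ ⊥L
    translate (⊥R d)            = ¬¬R (⊥R (translate d))
    translate (⊗R {Γ} d e)      = join Γ (¬¬R (⊗R (translate d) (translate e)))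
    translate (⊗L {C = C} d)    = ¬¬L-ˡᴳ C (⊗L (translate d))
    translate (⊸R d)            = ⊸R (translate d)
    translate (⊸L {Γ} {A = A} {B} d e) = join ((A ⊸ B) ∷ Γ) (⊸L (translate d) (translate e))
    translate (&R d e)          = &R (translate d) (translate e)
    translate (&L₁ d)           = &L₁ (translate d)
    translate (&L₂ d)           = &L₂ (translate d)
    translate (⊕R₁ d)           = ¬¬R (⊕R₁ (translate d))
    translate (⊕R₂ d)           = ¬¬R (⊕R₂ (translate d))
    translate (⊕L {C = C} d e)  = ¬¬L-ˡᴳ C (⊕L (translate d) (translate e))
    translate (∀R {Γ} {A} d)    =
      ∀R (≡.subst (S ∣_⊢ just (A ˡᴳ)) (map-ˡᴳ-↑ Γ) (translate d))
    translate (∀L {Γ} {A} {C} t d) =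
      ∀L t (≡.subst (λ B → S ∣ B ∷ map _ˡᴳ Γ ⊢ Maybe.map _ˡᴳ C)
                    (ˡᴳ-subst (instantiate t) A) (translate d))
    translate (∃R {Γ} {A} t d)  =
      ¬¬R (∃R t (≡.subst (λ B → S ∣ map _ˡᴳ Γ ⊢ just B)
                         (ˡᴳ-subst (instantiate t) A) (translate d)))
    translate (∃L {Γ} {A} {C} d) =
      ¬¬L-ˡᴳ C (∃L (≡.subst₂ (λ Δ D → S ∣ A ˡᴳ ∷ Δ ⊢ D) (map-ˡᴳ-↑ Γ) (maybe-ˡᴳ-↑ C)
                             (translate d)))
    -- Contraction applies to `! A ˡᴳ` only, so each of the two copies of its double negation is cut
    -- away first.
    translate (!C {C = C} d)    =
      ¬¬L-ˡᴳ C (!C (cut (¬¬R ax) (swapL (cut (¬¬R ax) (translate d)))))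
    translate (!W {C = C} d)    = ¬¬L-ˡᴳ C (!W (translate d))
    translate (!R {Γ} d)        = !R-ˡᴳ Γ (translate d)
    translate (!L {C = C} d)    = ¬¬L-ˡᴳ C (!L (translate d))

  -- Soundness and simplification.

  ˡᴳ-sound : Sound CLLb ILL⊥ _ˡᴳ
  ˡᴳ-sound = record
    { preserves  = λ _ → translate
    ; equivalent = λ A → ⊣⊢⇒⇔ (⊣⊢-trans (⊣⊢-sym (ᴷᵒ⊣⊢id A)) (ᴷᵒ⊣⊢ˡᴳ A))
    }

  ᴷᵒ-sound : Sound CLLb ILL⊥ _ᴷᵒ
  ᴷᵒ-sound = record
    { preserves  = λ A d → translate d ⟫ proj₂ (ᴷᵒ⊣⊢ˡᴳ A)
    ; equivalent = λ A → ⊣⊢⇒⇔ (⊣⊢-sym (ᴷᵒ⊣⊢id A))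
    }

  ˡᴳ-simplifies-ᴷᵒ : Simplification CLLb ILL⊥ linearGödelGentzen outerKolmogorov
  ˡᴳ-simplifies-ᴷᵒ = record
    { equivalent = record
      { sound′     = ˡᴳ-sound
      ; sound      = ᴷᵒ-sound
      ; equivalent = λ A → ⊣⊢⇒⇔ (ᴷᵒ⊣⊢ˡᴳ A)
      }
    ; binary     = λ { tensor → inj₁ refl ; with′ → inj₂ useId-simpler
                     ; plus → inj₁ refl ; lolli → inj₂ useId-simpler }
    ; unary      = λ { all → inj₂ useId-simpler ; ex → inj₁ refl ; bang → inj₁ refl }
    ; somewhere  = inj₁ (with′ , useId-simpler)
    }
    where
    useId-simpler : Simpler useId useT
    useId-simpler = (λ ()) , λ f → f _

  -- Reduction from the outside.

  -- For a variable A, Agda does not see A ᴷᵒ as a double negation; the core puts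
  -- the outermost one in sight, so that the reductions match definitionally.
  ᴷᵒ-core : Formula → Formula
  ᴷᵒ-core (atom P)    = atom P
  ᴷᵒ-core (bin □ A B) = bin □ (¬¬ ᴷᵒ-core A) (¬¬ ᴷᵒ-core B)
  ᴷᵒ-core (un Q A)    = un Q (¬¬ ᴷᵒ-core A)

  ¬¬ᴷᵒ-core : ∀ A → ¬¬ ᴷᵒ-core A ≡ A ᴷᵒ
  ¬¬ᴷᵒ-core (atom P)    = refl
  ¬¬ᴷᵒ-core (bin □ A B) = cong doubleNegation (cong₂ (bin □) (¬¬ᴷᵒ-core A) (¬¬ᴷᵒ-core B))
  ¬¬ᴷᵒ-core (un Q A)    = cong doubleNegation (cong (un Q) (¬¬ᴷᵒ-core A))

  core-reducesFromOutside : ∀ A → ReducesFromOutside linearGödelGentzen outerKolmogorov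
                                    (¬¬ ᴷᵒ-core A) (A ˡᴳ)
  core-reducesFromOutside (atom P) = stop λ ()
  core-reducesFromOutside (bin □ A B)
    -- Passing to the transform treats all four connectives at once; for `⊗` and `⊕` the two
    -- transforms agree and the reduction is the identity.
    rewrite ModularOuterTranslation.tr-bin linearGödelGentzen □ A B
    = reduce-bin □ (core-reducesFromOutside A) (core-reducesFromOutside B)
  core-reducesFromOutside (un Q A)
    rewrite ModularOuterTranslation.tr-un linearGödelGentzen Q A
    = reduce-un Q (core-reducesFromOutside A)

  Irreducible : Formula → Set
  Irreducible X = ∀ {Y} → Meta.¬ (X ↦ Y)

  -- `_↠_` descends through the two negations as through any implication, so irreducibility is
  -- checked at three formulas; it depends on the shape of `X`.
  ¬¬-keep : ∀ {X Y} → Irreducible (¬¬ X) → Irreducible (¬ X) → Irreducible X →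
            X ↠ₛ Y → ¬¬ X ↠ ¬¬ Y
  ¬¬-keep i j k r = keep i (bin (keep j (bin (keep k r) ⊥↠)) ⊥↠)
    where
    ⊥↠ : ⊥ ↠ ⊥
    ⊥↠ = keep (λ ()) atom

  -- Outside-in order matters: after a reduction the parts still carry the double negations that the
  -- induction hypotheses expect, whereas reducing a part first could destroy the redex around it.
  core↠ˡᴳ : ∀ A → ¬¬ ᴷᵒ-core A ↠ A ˡᴳ
  core↠ˡᴳ (atom P) = ¬¬-keep (λ ()) (λ ()) (λ ()) atom
  core↠ˡᴳ (A ⊗ B)  = ¬¬-keep (λ ()) (λ ()) (λ ()) (bin (core↠ˡᴳ A) (core↠ˡᴳ B))
  core↠ˡᴳ (A & B)  = reduce &-reduction (bin (core↠ˡᴳ A) (core↠ˡᴳ B))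
  core↠ˡᴳ (A ⊕ B)  = ¬¬-keep (λ ()) (λ ()) (λ ()) (bin (core↠ˡᴳ A) (core↠ˡᴳ B))
  core↠ˡᴳ (A ⊸ B)  = reduce ⊸-reduction (bin (core↠ˡᴳ A) (core↠ˡᴳ B))
  core↠ˡᴳ (∀′ A)   = reduce ∀-reduction (un (core↠ˡᴳ A))
  core↠ˡᴳ (∃′ A)   = ¬¬-keep (λ ()) (λ ()) (λ ()) (un (core↠ˡᴳ A))
  core↠ˡᴳ (! A)    = ¬¬-keep (λ ()) (λ ()) (λ ()) (un (core↠ˡᴳ A))

proposition12 : (𝓛 : Signature) → let open LinearLogic 𝓛 in
    ((A : Formula) → A ᴷᵒ ↠ A ˡᴳ)
    × SimplificationFromOutside CLLb ILL⊥ linearGödelGentzen outerKolmogorov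
    × (∀ {X Y} → X ↦ Y → ILL⊥ ⊢ X ⇔ Y)
proposition12 𝓛 =
    (λ A → ≡.subst (_↠ A ˡᴳ) (¬¬ᴷᵒ-core A) (core↠ˡᴳ A))
  , record
    { simplification = ˡᴳ-simplifies-ᴷᵒ
    ; fromOutside    = λ A →
        ≡.subst (λ X → ReducesFromOutside linearGödelGentzen outerKolmogorov X (A ˡᴳ))
                (¬¬ᴷᵒ-core A) (core-reducesFromOutside A)
    }
  , λ r → ⊣⊢⇒⇔ (reversible r)
  where open LinearLogic 𝓛
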